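{- For all sufficiently large integers $k$, there is a digraph $G_k$ with vertex set $\binom{[k]}{2}$ that satisfies the triangular substructure condition and for which $$\mathrm{dom}(G_k)\ge\frac{k^{3/2}}{8\sqrt{\log k}}=\tilde\Omega(k^{3/2}).$$
   Context: Here $\log$ is the base-2 logarithm, $[k]=\{1,\dots,k\}$ and $\binom{X}{t}=\{A\subseteq X:|A|=t\}$. Triangular substructure condition for a digraph with vertex set $\binom{[k]}{2}$: for every $\{j,j',j''\}\in\binom{[k]}{3}$ (and every naming $j,j',j''$ of its three elements), at least one of the following holds: (i) $\{j,j''\}\leftrightarrow\{j',j''\}$ (edges in both directions); (ii) $\{j,j'\}\to\{j,j''\}$; (iii) $\{j,j'\}\to\{j',j''\}$. A dominating set of a digraph $G=(V,E)$ is a subset $D\subseteq V$ such that for every $w\in V$ either $w\in D$ or there is $v\in D$ with $(v,w)\in E$. $\mathrm{dom}(G)$, the domination number, is the minimum size of a dominating set of $G$. $\tilde\Omega$ hides polylogarithmic factors. -}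

module Defs where

open import Data.Fin.Base using (Fin; zero; suc)
open import Data.Fin.Subset using (Subset; ∣_∣; ⁅_⁆; _∪_)
open import Data.Fin.Subset.Properties using (∣⁅x⁆∣≡1; ∪-identityˡ; ∪-identityʳ)
open import Data.Irrelevant using ([_])
open import Data.List.Base using (List; length)
open import Data.List.Membership.Propositional using (_∈_)
open import Data.List.Relation.Unary.Unique.Propositional using (Unique)
open import Data.Nat.Base using (ℕ; suc; _*_; _^_; _≤_)
open import Data.Nat.Logarithm using (⌈log₂_⌉)
open import Data.Product.Base using (∃-syntax; _×_)
open import Data.Refinement using (Refinement-syntax; _,_)
open import Data.Sum.Base using (_⊎_)
open import Level using (0ℓ)
open import Relation.Binary.Core using (Rel)
open import Relation.Binary.PropositionalEquality
  using (_≡_; _≢_; refl; cong; trans)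
open import Relation.Nullary.Negation using (¬_; contradiction)

-- The t-element subsets of a k-element set.  The cardinality proof is
-- irrelevant, so two elements are equal as soon as they are equal as subsets.
Choose : ℕ → ℕ → Set
Choose k t = [ A ∈ Subset k ∣ ∣ A ∣ ≡ t ]

∣⁅i⁆∪⁅j⁆∣≡2 : ∀ {k} (i j : Fin k) → i ≢ j → ∣ ⁅ i ⁆ ∪ ⁅ j ⁆ ∣ ≡ 2
∣⁅i⁆∪⁅j⁆∣≡2 zero    zero    i≢j = contradiction refl i≢j
∣⁅i⁆∪⁅j⁆∣≡2 zero    (suc j) _   =
  cong suc (trans (cong ∣_∣ (∪-identityˡ ⁅ j ⁆)) (∣⁅x⁆∣≡1 j))
∣⁅i⁆∪⁅j⁆∣≡2 (suc i) zero    _   =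
  cong suc (trans (cong ∣_∣ (∪-identityʳ ⁅ i ⁆)) (∣⁅x⁆∣≡1 i))
∣⁅i⁆∪⁅j⁆∣≡2 (suc i) (suc j) i≢j =
  ∣⁅i⁆∪⁅j⁆∣≡2 i j (λ i≡j → i≢j (cong suc i≡j))

pair : ∀ {k} (i j : Fin k) → i ≢ j → Choose k 2
pair i j i≢j = ⁅ i ⁆ ∪ ⁅ j ⁆ , [ ∣⁅i⁆∪⁅j⁆∣≡2 i j i≢j ]

-- Loops are excluded; they affect neither domination nor the triangular
-- condition.
record Digraph (V : Set) : Set₁ where
  field
    _⟶_    : Rel V 0ℓ
    irrefl : ∀ {v} → ¬ (v ⟶ v)

TriangularSubstructure : ∀ {k} → Digraph (Choose k 2) → Set
TriangularSubstructure {k} G =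
  ∀ (j j′ j″ : Fin k) (j≢j′ : j ≢ j′) (j≢j″ : j ≢ j″) (j′≢j″ : j′ ≢ j″) →
    (pair j j″ j≢j″ ⟶ pair j′ j″ j′≢j″ × pair j′ j″ j′≢j″ ⟶ pair j j″ j≢j″)
    ⊎ pair j j′ j≢j′ ⟶ pair j j″ j≢j″
    ⊎ pair j j′ j≢j′ ⟶ pair j′ j″ j′≢j″
  where open Digraph G

-- A finite vertex set is given by a duplicate-free list, of which `length` is
-- the cardinality.
record DominatingSet {V : Set} (G : Digraph V) (D : List V) : Set where
  open Digraph G
  field
    unique    : Unique D
    dominates : ∀ w → w ∈ D ⊎ (∃[ v ] v ∈ D × v ⟶ w)

-- dom(G) = d, i.e. d is the minimum size of a dominating set.
record DominationNumber {V : Set} (G : Digraph V) (d : ℕ) : Set where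
  field
    attained : ∃[ D ] DominatingSet G D × length D ≡ d
    minimal  : ∀ D → DominatingSet G D → d ≤ length D

-- d ≥ k^(3/2) / (8 √(log₂ k)), for k ≥ 2.  Squaring and clearing the
-- denominator gives k³ ≤ 64 d² log₂ k, and exponentiating (base 2) gives the
-- inequality below; each step is an equivalence.
_≥k^3/2÷8√log_ : ℕ → ℕ → Set
d ≥k^3/2÷8√log k = 2 ^ (k ^ 3) ≤ k ^ (64 * d ^ 2)

-- k^(3/2) ≤ c · d · ⌈log₂ k⌉^e, squared.  With c and e fixed and k → ∞ this
-- is d = Ω̃(k^(3/2)); rounding log₂ k up costs at most a factor of 2.
Ω̃-bound : (c e k d : ℕ) → Set
Ω̃-bound c e k d = k ^ 3 ≤ (c * d * ⌈log₂ k ⌉ ^ e) ^ 2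

{-# OPTIONS --safe #-}
module Submission where

-- Let H be the point–line incidence graph of the affine plane over 𝔽ₚ, drawn
-- on 2p² ≤ k of the points of [k]: it is bipartite, C₄-free and has p³ edges.
-- Let every pair point to every pair outside H, and for a < b with common
-- H-neighbour c (unique, as H is C₄-free) let {a,b} point to {a,c}.  A triangle
-- has at most two sides in H, which gives the triangular condition, and every
-- pair dominates at most one edge of H, so dom(G) = |H| = p³.
--
-- A prime p within a constant factor of √k suffices, since √(log k) absorbs all
-- constants.  It is found by Chebyshev's method: if no prime lies in (n, s²],
-- then s!² ∏_{p ≤ n} p ≤ s^{2s} 4ⁿ is a common multiple of 1, …, s², whereas any
-- common multiple of 1, …, 2m+1 is at least (2m)!/m!² ≥ 2ᵐ.

open import Defs
import Data.Bool.Properties as Bool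
open import Data.Fin.Base as Fin using (Fin; toℕ; fromℕ<; combine; remQuot; inject≤; _↑ˡ_; _↑ʳ_)
import Data.Fin.Properties as Fin
open import Data.Fin.Subset as Subset using (⁅_⁆)
open import Data.Fin.Subset.Properties using (x∈p∪q⁻; x∈p∪q⁺; x∈⁅x⁆; x∈⁅y⁆⇒x≡y; ∪-comm)
open import Data.Integer.Base as ℤ using (+_)
import Data.Integer.Divisibility.Signed as ℤ
import Data.Integer.Properties as ℤ
open import Data.Integer.Tactic.RingSolver using () renaming (solve-∀ to ℤ-solve-∀)
open import Data.List.Base using (List; []; _∷_; tabulate; lookup)
open import Data.List.Membership.Propositional using (_∈_)
open import Data.List.Membership.Propositional.Properties using (∈-tabulate⁺)
open import Data.List.Properties using (length-tabulate)
open import Data.List.Relation.Unary.All using (_∷_)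
open import Data.List.Relation.Unary.Any using (index)
open import Data.List.Relation.Unary.Any.Properties using (lookup-index)
open import Data.List.Relation.Unary.Unique.Propositional.Properties using (tabulate⁺)
open import Data.Nat.Base
open import Data.Nat.Combinatorics using (k![n∸k]!∣n!)
open import Data.Nat.Coprimality as Coprimality using (Coprime; coprime-divisor; prime⇒coprime)
open import Data.Nat.DivMod using (m%n<n; m≡m%n+[m/n]*n)
open import Data.Nat.Divisibility
open import Data.Nat.ListAction using (product)
open import Data.Nat.Primality
  using (Prime; prime?; ¬prime[0]; prime⇒nonZero; prime⇒nonTrivial; euclidsLemma)
open import Data.Nat.Primality.Factorisation using (PrimeFactorisation; factorise)
open import Data.Nat.Properties
open import Data.Nat.Tactic.RingSolver using (solve-∀)
open import Data.Product.Base using (∃-syntax; _×_; _,_; proj₁; proj₂)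
import Data.Refinement as Refinement
open import Data.Sum.Base as Sum using (_⊎_; inj₁; inj₂)
open import Data.Vec.Properties using (≡-dec)
open import Function.Base using (_∘_)
open import Relation.Binary.Definitions using (DecidableEquality; tri<; tri≈; tri>)
open import Relation.Binary.PropositionalEquality
open import Relation.Nullary.Decidable using (Dec; yes; no; _×-dec_)
open import Relation.Nullary.Negation using (¬_; contradiction)

-- Common multiples of an initial segment are exponentially large.

CommonMultiple : ℕ → ℕ → Set
CommonMultiple N T = ∀ {j} → 1 ≤ j → j ≤ N → j ∣ T

-- The recurrence of the Leibniz harmonic triangle, whose entries are the
-- reciprocals of (a+b+1)! / (a! b!), with denominators cleared.
leibniz-∣ : ∀ {N T} → CommonMultiple N T →
            ∀ a b → suc (a + b) ≤ N → suc (a + b) ! ∣ T * (a ! * b !)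
leibniz-∣ {T = T} cm zero b b<N =
  subst (λ x → suc b ! ∣ T * x) (sym (*-identityˡ (b !)))
    (*-monoˡ-∣ (b !) (cm (s≤s z≤n) b<N))
leibniz-∣ {N} {T} cm (suc a) b a+b<N = ∣m+n∣m⇒∣n
  (subst (suc (suc (a + b)) ! ∣_) (recurrence a b T (a !) (b !))
    (*-monoʳ-∣ (suc (suc (a + b))) (leibniz-∣ {N} {T} cm a b (<⇒≤ a+b<N))))
  (subst (λ c → suc c ! ∣ T * (a ! * suc b !)) (+-suc a b)
    (leibniz-∣ {N} {T} cm a (suc b) (subst (_≤ N) (cong suc (sym (+-suc a b))) a+b<N)))
  where
  recurrence : ∀ a b t x y →
    suc (suc (a + b)) * (t * (x * y)) ≡ t * (x * (suc b * y)) + t * (suc a * x * y)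
  recurrence = solve-∀

-- Pascal's rule with denominators cleared: the factor `m + n + 2` of the factorial splits as
-- `suc m + suc n`, and each summand meets an induction hypothesis with half the power of two.
[m+n]!≤2^[m+n]*m!*n! : ∀ m n → (m + n) ! ≤ 2 ^ (m + n) * (m ! * n !)
[m+n]!≤2^[m+n]*m!*n! zero    n       = begin
  n !                  ≤⟨ m≤n*m (n !) (2 ^ n) {{m^n≢0 2 n}} ⟩
  2 ^ n * n !          ≡⟨ cong (2 ^ n *_) (*-identityˡ (n !)) ⟨
  2 ^ n * (1 * n !)    ∎
  where open ≤-Reasoning
[m+n]!≤2^[m+n]*m!*n! (suc m) zero    = begin
  (suc m + 0) !                 ≡⟨ cong _! (+-identityʳ (suc m)) ⟩
  suc m !                       ≤⟨ m≤n*m (suc m !) (2 ^ (suc m + 0)) {{m^n≢0 2 (suc m + 0)}} ⟩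
  2 ^ (suc m + 0) * suc m !     ≡⟨ cong (2 ^ (suc m + 0) *_) (*-identityʳ (suc m !)) ⟨
  2 ^ (suc m + 0) * (suc m ! * 1) ∎
  where open ≤-Reasoning
[m+n]!≤2^[m+n]*m!*n! (suc m) (suc n) = begin
  (suc m + suc n) !
    ≡⟨ expand m n ((m + suc n) !) ⟩
  suc m * (m + suc n) ! + suc n * (m + suc n) !
    ≡⟨ cong (λ c → suc m * (m + suc n) ! + suc n * c !) (+-suc m n) ⟩
  suc m * (m + suc n) ! + suc n * (suc m + n) !
    ≤⟨ +-mono-≤ (*-monoʳ-≤ (suc m) ([m+n]!≤2^[m+n]*m!*n! m (suc n)))
                (*-monoʳ-≤ (suc n) ([m+n]!≤2^[m+n]*m!*n! (suc m) n)) ⟩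
  suc m * (2 ^ (m + suc n) * (m ! * suc n !)) + suc n * (2 ^ (suc m + n) * (suc m ! * n !))
    ≡⟨ cong (λ c → suc m * (2 ^ (m + suc n) * (m ! * suc n !))
                 + suc n * (2 ^ c * (suc m ! * n !))) (+-suc m n) ⟨
  suc m * (2 ^ (m + suc n) * (m ! * suc n !)) + suc n * (2 ^ (m + suc n) * (suc m ! * n !))
    ≡⟨ collect m n (2 ^ (m + suc n)) (m !) (n !) ⟩
  2 ^ (suc m + suc n) * (suc m ! * suc n !) ∎
  where
  open ≤-Reasoning
  expand : ∀ m n x → suc (m + suc n) * x ≡ suc m * x + suc n * x
  expand = solve-∀
  collect : ∀ m n c x y → suc m * (c * (x * (suc n * y))) + suc n * (c * (suc m * x * y))
                        ≡ 2 * c * (suc m * x * (suc n * y))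
  collect = solve-∀

-- From `m` to `suc m` the central binomial coefficient grows by the ratio (2m+2)(2m+1)/(m+1)²,
-- which is at least 2 because 2m+1 ≥ m+1.
2^m*m!*m!≤[m+m]! : ∀ m → 2 ^ m * (m ! * m !) ≤ (m + m) !
2^m*m!*m!≤[m+m]! zero    = ≤-refl
2^m*m!*m!≤[m+m]! (suc m) = begin
  2 ^ suc m * (suc m ! * suc m !)
    ≡⟨ regroup m (2 ^ m) (m !) ⟩
  (2 * suc m) * suc m * (2 ^ m * (m ! * m !))
    ≤⟨ *-mono-≤ (*-mono-≤ (≤-reflexive (double m)) (s≤s (m≤m+n m m))) (2^m*m!*m!≤[m+m]! m) ⟩
  suc (suc (m + m)) * suc (m + m) * (m + m) !
    ≡⟨ *-assoc (suc (suc (m + m))) (suc (m + m)) ((m + m) !) ⟩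
  suc (suc (m + m)) !
    ≡⟨ cong (λ c → suc c !) (+-suc m m) ⟨
  (suc m + suc m) ! ∎
  where
  open ≤-Reasoning
  regroup : ∀ m c x → 2 * c * (suc m * x * (suc m * x)) ≡ (2 * suc m) * suc m * (c * (x * x))
  regroup = solve-∀
  double : ∀ m → 2 * suc m ≡ suc (suc (m + m))
  double = solve-∀

-- The middle entry `a = b = m` of the Leibniz triangle gives (2m+1)! ≤ T·m!²; discarding the factor
-- 2m+1 leaves a central binomial coefficient below `T`.
2^m≤commonMultiple : ∀ {N T} .{{_ : NonZero T}} → CommonMultiple N T →
                     ∀ m → suc (m + m) ≤ N → 2 ^ m ≤ T
2^m≤commonMultiple {T = T} cm m 2m<N = *-cancelʳ-≤ (2 ^ m) T (m ! * m !) (begin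
  2 ^ m * (m ! * m !)   ≤⟨ 2^m*m!*m!≤[m+m]! m ⟩
  (m + m) !             ≤⟨ m≤n*m ((m + m) !) (suc (m + m)) ⟩
  suc (m + m) !         ≤⟨ ∣⇒≤ (leibniz-∣ cm m m 2m<N) ⟩
  T * (m ! * m !)       ∎)
  where
  open ≤-Reasoning
  instance
    m!*m!≢0 : NonZero (m ! * m !)
    m!*m!≢0 = m !* m !≢0
    T*m!*m!≢0 : NonZero (T * (m ! * m !))
    T*m!*m!≢0 = m*n≢0 T (m ! * m !)

-- Products of primes in intervals, and the primorial.

primeOr1 : ℕ → ℕ
primeOr1 n with prime? n
... | yes _ = n
... | no  _ = 1

primeOr1-prime : ∀ {p} → Prime p → primeOr1 p ≡ p
primeOr1-prime {p} prime[p] with prime? p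
... | yes _ = refl
... | no ¬p = contradiction prime[p] ¬p

primeOr1-∣ : ∀ n → primeOr1 n ∣ n
primeOr1-∣ n with prime? n
... | yes _ = ∣-refl
... | no  _ = 1∣ n

primeOr1-nonZero : ∀ n .{{_ : NonZero n}} → NonZero (primeOr1 n)
primeOr1-nonZero (suc n) with prime? (suc n)
... | yes _ = _
... | no  _ = _

-- Intervals are given by start and length, so `primeProduct 0 n` is the primorial of `n` and
-- adjacent intervals concatenate by `primeProduct-+`.
primeProduct : (h g : ℕ) → ℕ
primeProduct h zero    = 1
primeProduct h (suc g) = primeOr1 (suc (h + g)) * primeProduct h g

primeProduct-nonZero : ∀ h g → NonZero (primeProduct h g)
primeProduct-nonZero h zero    = _
primeProduct-nonZero h (suc g) =
  m*n≢0 _ _ {{primeOr1-nonZero (suc (h + g))}} {{primeProduct-nonZero h g}}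

primeProduct-+ : ∀ h g → primeProduct 0 (h + g) ≡ primeProduct h g * primeProduct 0 h
primeProduct-+ h zero    rewrite +-identityʳ h = sym (+-identityʳ _)
primeProduct-+ h (suc g) rewrite +-suc h g | primeProduct-+ h g =
  sym (*-assoc (primeOr1 (suc (h + g))) (primeProduct h g) (primeProduct 0 h))

prime∣primeProduct : ∀ {p n} → Prime p → p ≤ n → p ∣ primeProduct 0 n
prime∣primeProduct {zero}  {zero}  prime[0] _ = contradiction prime[0] ¬prime[0]
prime∣primeProduct {p} {suc n} prime[p] p≤1+n with m≤n⇒m<n∨m≡n p≤1+n
... | inj₁ (s≤s p≤n) = ∣n⇒∣m*n (primeOr1 (suc n)) (prime∣primeProduct prime[p] p≤n)
... | inj₂ refl      =
  ∣m⇒∣m*n (primeProduct 0 n) (∣-reflexive (sym (primeOr1-prime prime[p])))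

-- Each prime in the interval is itself one of the factors h+1, ..., h+g; `r` collects what the
-- product leaves over.
primeProduct-cofactor : ∀ h g → ∃[ r ] (h + g) ! ≡ h ! * (primeProduct h g * r)
primeProduct-cofactor h zero    = 1 , trans (cong _! (+-identityʳ h)) (sym (*-identityʳ (h !)))
primeProduct-cofactor h (suc g)
  with r , eq ← primeProduct-cofactor h g | divides q q*p≡ ← primeOr1-∣ (suc (h + g)) =
  q * r , (begin
    (h + suc g) !                     ≡⟨ cong _! (+-suc h g) ⟩
    suc (h + g) * (h + g) !           ≡⟨ cong₂ _*_ q*p≡ eq ⟩
    q * p * (h ! * (primeProduct h g * r)) ≡⟨ regroup q p (h !) (primeProduct h g) r ⟩
    h ! * (p * primeProduct h g * (q * r)) ∎)
  where
  open ≡-Reasoning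
  p = primeOr1 (suc (h + g))
  regroup : ∀ q p x y r → q * p * (x * (y * r)) ≡ x * (p * y * (q * r))
  regroup = solve-∀

coprime-* : ∀ {a b c} → Coprime a c → Coprime b c → Coprime (a * b) c
coprime-* a⊥c b⊥c (d∣ab , d∣c) = b⊥c
  (coprime-divisor (λ (e∣d , e∣a) → a⊥c (e∣a , ∣-trans e∣d d∣c)) d∣ab , d∣c)

prime-coprime-! : ∀ {p} → Prime p → ∀ {c} → c < p → Coprime p (c !)
prime-coprime-! _ {zero}  _   = Coprimality.sym (Coprimality.1-coprimeTo _)
prime-coprime-! P {suc c} c<p = Coprimality.sym (coprime-*
  (Coprimality.sym (prime⇒coprime P c<p))
  (Coprimality.sym (prime-coprime-! P (<-trans (n<1+n c) c<p))))

-- Every prime in the product exceeds `h ≥ c`, so it divides no factor of `c !`.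
primeProduct-coprime-! : ∀ {h c} → c ≤ h → ∀ g → Coprime (primeProduct h g) (c !)
primeProduct-coprime-!     c≤h zero = Coprimality.1-coprimeTo _
primeProduct-coprime-! {h} c≤h (suc g) with prime? (suc (h + g))
... | yes P = coprime-* (prime-coprime-! P (s≤s (≤-trans c≤h (m≤m+n h g))))
                        (primeProduct-coprime-! c≤h g)
... | no  _ = coprime-* {1} (Coprimality.1-coprimeTo _) (primeProduct-coprime-! c≤h g)

m!*n!∣[m+n]! : ∀ m n → m ! * n ! ∣ (m + n) !
m!*n!∣[m+n]! m n = subst (λ c → m ! * c ! ∣ (m + n) !) (m+n∸m≡n m n) (k![n∸k]!∣n! (m≤m+n m n))

-- The primes in (h, h + g] divide the numerator of (h+g)! / (h! g!), but not g!.
primeProduct≤2^ : ∀ {h g} → g ≤ h → primeProduct h g ≤ 2 ^ (h + g)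
primeProduct≤2^ {h} {g} g≤h with r , eq ← primeProduct-cofactor h g =
  *-cancelʳ-≤ Q (2 ^ (h + g)) (g !) {{g !≢0}} (begin
    Q * g !              ≤⟨ *-monoʳ-≤ Q (∣⇒≤ {{r≢0}} g!∣r) ⟩
    Q * r                ≤⟨ *-cancelˡ-≤ (h !) {{h !≢0}} (begin
      h ! * (Q * r)                ≡⟨ eq ⟨
      (h + g) !                    ≤⟨ [m+n]!≤2^[m+n]*m!*n! h g ⟩
      2 ^ (h + g) * (h ! * g !)    ≡⟨ regroup (2 ^ (h + g)) (h !) (g !) ⟩
      h ! * (2 ^ (h + g) * g !)    ∎) ⟩
    2 ^ (h + g) * g !    ∎)
  where
  open ≤-Reasoning
  Q = primeProduct h g
  regroup : ∀ c x y → c * (x * y) ≡ x * (c * y)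
  regroup = solve-∀
  Q*r≢0 : NonZero (h ! * (Q * r))
  Q*r≢0 = subst NonZero eq ((h + g) !≢0)
  r≢0 : NonZero r
  r≢0 = m*n≢0⇒n≢0 Q {{m*n≢0⇒n≢0 (h !) {{Q*r≢0}}}}
  g!∣Q*r : g ! ∣ Q * r
  g!∣Q*r = *-cancelˡ-∣ (h !) {{h !≢0}} (subst (h ! * g ! ∣_) eq (m!*n!∣[m+n]! h g))
  g!∣r : g ! ∣ r
  g!∣r = coprime-divisor (Coprimality.sym (primeProduct-coprime-! g≤h g)) g!∣Q*r

-- Doubling from x to 2x adds the primes in (x, 2x], whose product is at most 2^(2x), exactly the
-- growth of the exponent. Powers of two suffice because the bound is applied to n = x² with x a
-- power of two.
primorial[2^j]≤2^ : ∀ j → primeProduct 0 (2 ^ j) ≤ 2 ^ (2 * 2 ^ j)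
primorial[2^j]≤2^ zero    = s≤s z≤n
primorial[2^j]≤2^ (suc j) = begin
  primeProduct 0 (2 * x)                    ≡⟨ cong (λ y → primeProduct 0 (x + y)) (+-identityʳ x) ⟩
  primeProduct 0 (x + x)                    ≡⟨ primeProduct-+ x x ⟩
  primeProduct x x * primeProduct 0 x       ≤⟨ *-mono-≤ (primeProduct≤2^ {x} ≤-refl) (primorial[2^j]≤2^ j) ⟩
  2 ^ (x + x) * 2 ^ (2 * x)                 ≡⟨ ^-distribˡ-+-* 2 (x + x) (2 * x) ⟨
  2 ^ (x + x + 2 * x)                       ≡⟨ cong (2 ^_) (regroup x) ⟩
  2 ^ (2 * (2 * x))                         ∎
  where
  open ≤-Reasoning
  x = 2 ^ j
  regroup : ∀ x → x + x + 2 * x ≡ 2 * (2 * x)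
  regroup = solve-∀

-- Small common multiples across a prime gap, and a prime within a factor of sixteen.

record MaxDivisor (j s : ℕ) : Set where
  field
    {a}  : ℕ
    a∣j  : a ∣ j
    a≤s  : a ≤ s
    max  : ∀ {d} → d ∣ j → d ≤ s → d ≤ a

maxDivisor : ∀ j s .{{_ : NonZero s}} → MaxDivisor j s
maxDivisor j 1               = record { a∣j = 1∣ j; a≤s = ≤-refl; max = λ _ d≤1 → d≤1 }
maxDivisor j (suc s@(suc _)) with suc s ∣? j | maxDivisor j s
... | yes s∣j | _ = record { a∣j = s∣j; a≤s = ≤-refl; max = λ _ d≤s → d≤s }
... | no  s∤j | m = record
  { a∣j = a∣j
  ; a≤s = m≤n⇒m≤1+n a≤s
  ; max = λ d∣j d≤1+s → max d∣j (s≤s⁻¹ (≤∧≢⇒< d≤1+s λ { refl → s∤j d∣j }))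
  }
  where open MaxDivisor m

m≤n⇒m∣n! : ∀ {m n} .{{_ : NonZero m}} → m ≤ n → m ∣ n !
m≤n⇒m∣n! {suc m} m≤n = ∣-trans (m∣m*n (m !)) (m≤n⇒m!∣n! m≤n)

n!≤n^n : ∀ n → n ! ≤ n ^ n
n!≤n^n zero    = ≤-refl
n!≤n^n (suc n) = *-monoʳ-≤ (suc n) (≤-trans (n!≤n^n n) (^-monoˡ-≤ n (n≤1+n n)))

-- Let a be the largest divisor of j with a ≤ s, and let q be a prime factor of
-- j / a.  Then a q > s, so j / (a q) ≤ s whenever j ≤ s².
smooth-commonMultiple : ∀ n s .{{_ : NonZero s}} → (∀ {q} → Prime q → q ≤ s * s → q ≤ n) →
                        CommonMultiple (s * s) (s ! * s ! * primeProduct 0 n)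
smooth-commonMultiple n s smooth {j} 1≤j j≤s² = go (factorise b {{b≢0}})
  where
  open MaxDivisor (maxDivisor j s)
  b = quotient a∣j
  j≡a*b : j ≡ a * b
  j≡a*b = m∣n⇒n≡m*quotient a∣j
  a*b≢0 : NonZero (a * b)
  a*b≢0 = subst NonZero j≡a*b (>-nonZero 1≤j)
  b≢0 : NonZero b
  b≢0 = m*n≢0⇒n≢0 a {{a*b≢0}}
  a≢0 : NonZero a
  a≢0 = m*n≢0⇒m≢0 a {{a*b≢0}}
  a∣s! : a ∣ s !
  a∣s! = m≤n⇒m∣n! {{a≢0}} a≤s
  regroup : ∀ a q c → a * (q * c) ≡ a * c * q
  regroup = solve-∀
  go : PrimeFactorisation b → j ∣ s ! * s ! * primeProduct 0 n
  go record { factors = []; isFactorisation = b≡1 } =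
    subst (_∣ _) (sym (trans j≡a*b (trans (cong (a *_) b≡1) (*-identityʳ a))))
      (∣m⇒∣m*n _ (∣m⇒∣m*n (s !) a∣s!))
  go record { factors = q ∷ qs; isFactorisation = b≡q*c; factorsPrime = P ∷ _ } =
    subst (_∣ _) (sym (trans j≡ (regroup a q c)))
      (*-pres-∣ (*-pres-∣ a∣s! (m≤n⇒m∣n! {{c≢0}} c≤s)) (prime∣primeProduct P (smooth P q≤s²)))
    where
    c = product qs
    j≡ : j ≡ a * (q * c)
    j≡ = trans j≡a*b (cong (a *_) b≡q*c)
    c≢0 : NonZero c
    c≢0 = m*n≢0⇒n≢0 q {{subst NonZero b≡q*c b≢0}}
    q∣j : q ∣ j
    q∣j = subst (q ∣_) (sym j≡) (∣n⇒∣m*n a (m∣m*n c))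
    q≤s² : q ≤ s * s
    q≤s² = ≤-trans (∣⇒≤ {{>-nonZero 1≤j}} q∣j) j≤s²
    aq∣j : a * q ∣ j
    aq∣j = subst (a * q ∣_) (sym (trans j≡ (sym (*-assoc a q c)))) (m∣m*n c)
    a<aq : a < a * q
    a<aq = m<m*n a q {{a≢0}} (nonTrivial⇒n>1 q {{prime⇒nonTrivial P}})
    s<aq : s < a * q
    s<aq = ≰⇒> λ aq≤s → <⇒≱ a<aq (max aq∣j aq≤s)
    c≤s : c ≤ s
    c≤s = ≮⇒≥ λ s<c → <⇒≱ (*-mono-< s<aq s<c)
      (≤-trans (≤-reflexive (trans (*-assoc a q c) (sym j≡))) j≤s²)

-- This makes the contribution of `s ! * s !` to the exponent linear in n. The offset 4 is the first
-- exponent from which the inequality holds onwards.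
2*[t+2]≤2^t : ∀ u → 2 * (4 + u + 2) ≤ 2 ^ (4 + u)
2*[t+2]≤2^t zero    = m≤m+n 12 4
2*[t+2]≤2^t (suc u) = begin
  2 * (5 + u + 2)                  ≤⟨ m≤m+n (2 * (5 + u + 2)) (2 * (5 + u)) ⟩
  2 * (5 + u + 2) + 2 * (5 + u)    ≡⟨ regroup u ⟩
  2 * (2 * (4 + u + 2))            ≤⟨ *-monoʳ-≤ 2 (2*[t+2]≤2^t u) ⟩
  2 ^ (5 + u)                      ∎
  where
  open ≤-Reasoning
  regroup : ∀ u → 2 * (5 + u + 2) + 2 * (5 + u) ≡ 2 * (2 * (4 + u + 2))
  regroup = solve-∀

-- With n = x² and s = 4x, a prime-free interval (n, s²] yields a common multiple of 1, ..., 16n of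
-- size at most 2^(4n)·2^(2n), the first factor coming from `s ! * s !` and the second from the
-- primorial; yet it must be at least 2^(7n).
prime-in-[x²,16x²] : ∀ u → let x = 2 ^ (4 + u) in ∃[ p ] Prime p × x * x < p × p ≤ 16 * (x * x)
-- The search bound is strict, so `suc` admits 16x² itself. Decidability of the bounded search makes
-- the refutation of the negative case constructive.
prime-in-[x²,16x²] u with anyUpTo? (λ p → x * x <? p ×-dec prime? p) (suc (16 * (x * x)))
  where x = 2 ^ (4 + u)
... | yes (p , s≤s p≤ , n<p , P) = p , P , n<p , p≤
... | no none = contradiction absurd (<⇒≱ 6n<7n)
  where
  open ≤-Reasoning
  t = 4 + u
  x = 2 ^ t
  n = x * x
  s = 4 * x
  s≡2^ : s ≡ 2 ^ (2 + t)
  s≡2^ = *-assoc 2 2 x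
  s²≡ : s * s ≡ 16 * (x * x)
  s²≡ = square x
    where
    square : ∀ x → (4 * x) * (4 * x) ≡ 16 * (x * x)
    square = solve-∀
  instance
    x≢0 : NonZero x
    x≢0 = m^n≢0 2 t
    n≢0 : NonZero n
    n≢0 = m*n≢0 x x
    s≢0 : NonZero s
    s≢0 = m*n≢0 4 x
  T = s ! * s ! * primeProduct 0 n
  T≢0 : NonZero T
  T≢0 = m*n≢0 _ _ {{s !* s !≢0}} {{primeProduct-nonZero 0 n}}
  T-common : CommonMultiple (s * s) T
  T-common = smooth-commonMultiple n s
    λ {q} P q≤s² → ≮⇒≥ λ n<q → none (q , s≤s (≤-trans q≤s² (≤-reflexive s²≡)) , n<q , P)
  s!≤ : s ! ≤ 2 ^ ((2 + t) * s)
  s!≤ = begin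
    s !                    ≤⟨ n!≤n^n s ⟩
    s ^ s                  ≡⟨ cong (_^ s) s≡2^ ⟩
    (2 ^ (2 + t)) ^ s      ≡⟨ ^-*-assoc 2 (2 + t) s ⟩
    2 ^ ((2 + t) * s)      ∎
  primorial≤ : primeProduct 0 n ≤ 2 ^ (2 * n)
  primorial≤ = subst (λ n → primeProduct 0 n ≤ 2 ^ (2 * n)) (^-distribˡ-+-* 2 t t)
    (primorial[2^j]≤2^ (t + t))
  T≤ : T ≤ 2 ^ ((2 + t) * s + (2 + t) * s + 2 * n)
  T≤ = begin
    T ≤⟨ *-mono-≤ (*-mono-≤ s!≤ s!≤) primorial≤ ⟩
    2 ^ ((2 + t) * s) * 2 ^ ((2 + t) * s) * 2 ^ (2 * n)
      ≡⟨ cong (_* 2 ^ (2 * n)) (^-distribˡ-+-* 2 ((2 + t) * s) ((2 + t) * s)) ⟨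
    2 ^ ((2 + t) * s + (2 + t) * s) * 2 ^ (2 * n)
      ≡⟨ ^-distribˡ-+-* 2 ((2 + t) * s + (2 + t) * s) (2 * n) ⟨
    2 ^ ((2 + t) * s + (2 + t) * s + 2 * n) ∎
  exponent≤ : (2 + t) * s + (2 + t) * s + 2 * n ≤ 6 * n
  exponent≤ = begin
    (2 + t) * s + (2 + t) * s + 2 * n  ≡⟨ regroup t x ⟩
    4 * ((2 * (t + 2)) * x) + 2 * n    ≤⟨ +-monoˡ-≤ (2 * n) (*-monoʳ-≤ 4 (*-monoˡ-≤ x (2*[t+2]≤2^t u))) ⟩
    4 * n + 2 * n                      ≡⟨ *-distribʳ-+ n 4 2 ⟨
    6 * n                              ∎
    where
    regroup : ∀ t x → (2 + t) * (4 * x) + (2 + t) * (4 * x) + 2 * (x * x)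
                    ≡ 4 * ((2 * (t + 2)) * x) + 2 * (x * x)
    regroup = solve-∀
  6n<7n : 2 ^ (6 * n) < 2 ^ (7 * n)
  6n<7n = ^-monoʳ-< 2 (s≤s (s≤s z≤n)) (*-monoˡ-< n (n<1+n 6))
  -- The choice m = 7n needs 14n + 1 ≤ 16n, while 7n already beats the upper exponent 6n.
  14n<s² : suc (7 * n + 7 * n) ≤ s * s
  14n<s² = begin
    1 + (7 * n + 7 * n)     ≤⟨ +-monoˡ-≤ _ (≤-trans (>-nonZero⁻¹ n) (m≤n*m n 2)) ⟩
    2 * n + (7 * n + 7 * n) ≡⟨ total n ⟩
    16 * n                  ≡⟨ s²≡ ⟨
    s * s                   ∎
    where
    total : ∀ n → 2 * n + (7 * n + 7 * n) ≡ 16 * n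
    total = solve-∀
  absurd : 2 ^ (7 * n) ≤ 2 ^ (6 * n)
  absurd = begin
    2 ^ (7 * n)                             ≤⟨ 2^m≤commonMultiple {{T≢0}} T-common (7 * n) 14n<s² ⟩
    T                                       ≤⟨ T≤ ⟩
    2 ^ ((2 + t) * s + (2 + t) * s + 2 * n) ≤⟨ ^-monoʳ-≤ 2 exponent≤ ⟩
    2 ^ (6 * n)                             ∎

-- The digraph of a C₄-free bipartite graph and its domination number.

_≟₂_ : ∀ {k t} → DecidableEquality (Choose k t)
_≟₂_ = Refinement._≟_ (≡-dec Bool._≟_)

pair-injective : ∀ {k} {i j i′ j′ : Fin k} (i≢j : i ≢ j) (i′≢j′ : i′ ≢ j′) →
                 pair i j i≢j ≡ pair i′ j′ i′≢j′ → (i ≡ i′ × j ≡ j′) ⊎ (i ≡ j′ × j ≡ i′)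
pair-injective {i = i} {j} {i′} {j′} i≢j _ eq
  with member i (inj₁ (x∈⁅x⁆ i)) | member j (inj₂ (x∈⁅x⁆ j))
  where
  member : ∀ x → x Subset.∈ ⁅ i ⁆ ⊎ x Subset.∈ ⁅ j ⁆ → x ≡ i′ ⊎ x ≡ j′
  member x x∈ = Sum.map (x∈⁅y⁆⇒x≡y i′) (x∈⁅y⁆⇒x≡y j′)
    (x∈p∪q⁻ ⁅ i′ ⁆ ⁅ j′ ⁆ (subst (x Subset.∈_) (cong Refinement.value eq) (x∈p∪q⁺ x∈)))
... | inj₁ refl | inj₁ refl = contradiction refl i≢j
... | inj₁ i≡i′ | inj₂ j≡j′ = inj₁ (i≡i′ , j≡j′)
... | inj₂ i≡j′ | inj₁ j≡i′ = inj₂ (i≡j′ , j≡i′)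
... | inj₂ refl | inj₂ refl = contradiction refl i≢j

pair-comm : ∀ {k} (i j : Fin k) (i≢j : i ≢ j) (j≢i : j ≢ i) → pair i j i≢j ≡ pair j i j≢i
pair-comm i j _ _ = Refinement.value-injective (∪-comm ⁅ i ⁆ ⁅ j ⁆)

-- The edges are enumerated by `Fin N` and oriented from one side to the other; `src≢tgt` for
-- independent `e` and `f` is bipartiteness. `C₄-free` says that a closed walk of four edges is
-- degenerate: its two sources or its two targets coincide.
record C₄-free-bipartite (k N : ℕ) : Set where
  field
    src tgt  : Fin N → Fin k
    src≢tgt  : ∀ e f → src e ≢ tgt f
    simple   : ∀ {e f} → src e ≡ src f → tgt e ≡ tgt f → e ≡ f
    C₄-free  : ∀ {e₁ e₂ e₃ e₄} → src e₁ ≡ src e₂ → src e₃ ≡ src e₄ →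
               tgt e₁ ≡ tgt e₃ → tgt e₂ ≡ tgt e₄ → src e₁ ≡ src e₃ ⊎ tgt e₁ ≡ tgt e₂

module Construction {k N} (B : C₄-free-bipartite k N) (e₀ : Fin N) where
  open C₄-free-bipartite B

  edge : Fin N → Choose k 2
  edge e = pair (src e) (tgt e) (src≢tgt e e)

  edges : List (Choose k 2)
  edges = tabulate edge

  edge-injective : ∀ {e f} → edge e ≡ edge f → e ≡ f
  edge-injective {e} {f} eq with pair-injective (src≢tgt e e) (src≢tgt f f) eq
  ... | inj₁ (s≡ , t≡) = simple s≡ t≡
  ... | inj₂ (s≡t , _) = contradiction s≡t (src≢tgt e f)

  IsEdge : Choose k 2 → Set
  IsEdge v = ∃[ e ] v ≡ edge e

  isEdge? : ∀ v → Dec (IsEdge v)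
  isEdge? v = Fin.any? (λ e → v ≟₂ edge e)

  data Adj : Fin k → Fin k → Set where
    fwd : ∀ e → Adj (src e) (tgt e)
    bwd : ∀ e → Adj (tgt e) (src e)

  isEdge⇒adj : ∀ {i j} (i≢j : i ≢ j) → IsEdge (pair i j i≢j) → Adj i j
  isEdge⇒adj i≢j (e , eq) with pair-injective i≢j (src≢tgt e e) eq
  ... | inj₁ (refl , refl) = fwd e
  ... | inj₂ (refl , refl) = bwd e

  private
    Left Right : Fin k → Set
    Left  i = ∃[ e ] i ≡ src e
    Right i = ∃[ e ] i ≡ tgt e

    left-right : ∀ {i} → Left i → ¬ Right i
    left-right (e , i≡) (f , i≡′) = src≢tgt e f (trans (sym i≡) i≡′)

    sides : ∀ {i j} → Adj i j → (Left i × Right j) ⊎ (Right i × Left j)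
    sides (fwd e) = inj₁ ((e , refl) , (e , refl))
    sides (bwd e) = inj₂ ((e , refl) , (e , refl))

  -- An odd cycle cannot alternate between the two sides; in each case some vertex would lie on
  -- both.
  triangle-free : ∀ {i j c} → Adj i c → Adj j c → ¬ Adj i j
  triangle-free ic jc ij with sides ic | sides jc | sides ij
  ... | inj₁ (li , _)  | _              | inj₂ (ri , _) = left-right li ri
  ... | inj₁ (_ , rc)  | inj₂ (_ , lc)  | _             = left-right lc rc
  ... | inj₁ _         | inj₁ (lj , _)  | inj₁ (_ , rj) = left-right lj rj
  ... | inj₂ (ri , _)  | _              | inj₁ (li , _) = left-right li ri
  ... | inj₂ (_ , lc)  | inj₁ (_ , rc)  | _             = left-right lc rc
  ... | inj₂ _         | inj₂ (rj , _)  | inj₂ (_ , lj) = left-right lj rj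

  edgeˡ : ∀ {i c} → Left i → Adj i c → ∃[ e ] i ≡ src e × c ≡ tgt e
  edgeˡ _ (fwd e) = e , refl , refl
  edgeˡ l (bwd e) = contradiction (e , refl) (left-right l)

  edgeʳ : ∀ {i c} → Right i → Adj i c → ∃[ e ] i ≡ tgt e × c ≡ src e
  edgeʳ r (fwd e) = contradiction r (left-right (e , refl))
  edgeʳ _ (bwd e) = e , refl , refl

  -- Vertices with a common neighbour lie on the same side, so two common neighbours would close a
  -- 4-cycle.
  common-neighbour-unique : ∀ {i j c c′} → i ≢ j → Adj i c → Adj j c → Adj i c′ → Adj j c′ → c ≡ c′
  common-neighbour-unique i≢j ic jc ic′ jc′ with sides ic | sides jc
  ... | inj₁ (_ , rc) | inj₂ (_ , lc) = contradiction rc (left-right lc)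
  ... | inj₂ (_ , lc) | inj₁ (_ , rc) = contradiction rc (left-right lc)
  ... | inj₁ (li , _) | inj₁ (lj , _)
    with edgeˡ li ic | edgeˡ li ic′ | edgeˡ lj jc | edgeˡ lj jc′
  ...   | e₁ , i₁ , c₁ | e₂ , i₂ , c₂ | e₃ , j₃ , c₃ | e₄ , j₄ , c₄
    with C₄-free (trans (sym i₁) i₂) (trans (sym j₃) j₄) (trans (sym c₁) c₃) (trans (sym c₂) c₄)
  ...     | inj₁ s≡ = contradiction (trans i₁ (trans s≡ (sym j₃))) i≢j
  ...     | inj₂ t≡ = trans c₁ (trans t≡ (sym c₂))
  -- Here `i` and `j` are targets, so the two outcomes of `C₄-free` exchange roles.
  common-neighbour-unique i≢j ic jc ic′ jc′ | inj₂ (ri , _) | inj₂ (rj , _)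
    with edgeʳ ri ic | edgeʳ ri ic′ | edgeʳ rj jc | edgeʳ rj jc′
  ...   | e₁ , i₁ , c₁ | e₂ , i₂ , c₂ | e₃ , j₃ , c₃ | e₄ , j₄ , c₄
    with C₄-free (trans (sym c₁) c₃) (trans (sym c₂) c₄) (trans (sym i₁) i₂) (trans (sym j₃) j₄)
  ...     | inj₁ s≡ = trans c₁ (trans s≡ (sym c₂))
  ...     | inj₂ t≡ = contradiction (trans i₁ (trans t≡ (sym j₃))) i≢j

  -- A path i – c – j of edges gives one arc from {i, j} into the set of edges;
  -- ordering i < j selects which of {i, c} and {j, c} receives it.
  data Hits : Choose k 2 → Choose k 2 → Set where
    hits : ∀ {i j c} (i≢j : i ≢ j) (i≢c : i ≢ c) → i Fin.< j → Adj i c → Adj j c →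
           Hits (pair i j i≢j) (pair i c i≢c)

  hits-from-nonedge : ∀ {u w} → Hits u w → ¬ IsEdge u
  hits-from-nonedge (hits i≢j _ _ ic jc) u∈ = triangle-free ic jc (isEdge⇒adj i≢j u∈)

  -- The order `i < j` fixes which endpoint is kept, and C₄-freeness fixes `c`. The equation
  -- `u ≡ u′` is explicit because a pair determines its endpoints only up to order.
  hits-unique : ∀ {u w u′ w′} → u ≡ u′ → Hits u w → Hits u′ w′ → w ≡ w′
  hits-unique eq (hits i≢j _ i<j ic jc) (hits i′≢j′ _ i′<j′ ic′ jc′)
    with pair-injective i≢j i′≢j′ eq
  ... | inj₂ (refl , refl) = contradiction i′<j′ (Fin.<-asym i<j)
  ... | inj₁ (refl , refl) with refl ← common-neighbour-unique i≢j ic jc ic′ jc′ = refl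

  G : Digraph (Choose k 2)
  G = record
    { _⟶_    = λ u w → u ≢ w × (¬ IsEdge w ⊎ Hits u w)
    ; irrefl = λ (v≢v , _) → v≢v refl
    }

  triangular : TriangularSubstructure G
  triangular i j c i≢j i≢c j≢c with isEdge? (pair i c i≢c) | isEdge? (pair j c j≢c)
  -- A side outside the graph receives arcs from all other pairs, in particular from `{i, j}`.
  ... | no ic∉ | _ = inj₂ (inj₁ (ij≢ic , inj₁ ic∉))
    where
    ij≢ic : pair i j i≢j ≢ pair i c i≢c
    ij≢ic eq with pair-injective i≢j i≢c eq
    ... | inj₁ (_ , j≡c) = j≢c j≡c
    ... | inj₂ (i≡c , _) = i≢c i≡c
  ... | _ | no jc∉ = inj₂ (inj₂ (ij≢jc , inj₁ jc∉))
    where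
    ij≢jc : pair i j i≢j ≢ pair j c j≢c
    ij≢jc eq with pair-injective i≢j j≢c eq
    ... | inj₁ (i≡j , _) = i≢j i≡j
    ... | inj₂ (i≡c , _) = i≢c i≡c
  -- With both sides in the graph, `i – c – j` is a path, and the smaller of `i` and `j` tells which
  -- side `{i, j}` hits.
  ... | yes ic∈ | yes jc∈ with Fin.<-cmp i j
  ...   | tri≈ _ i≡j _ = contradiction i≡j i≢j
  ...   | tri< i<j _ _ = inj₂ (inj₁ ((λ eq → hits-from-nonedge h (subst IsEdge (sym eq) ic∈)) , inj₂ h))
    where
    h : Hits (pair i j i≢j) (pair i c i≢c)
    h = hits i≢j i≢c i<j (isEdge⇒adj i≢c ic∈) (isEdge⇒adj j≢c jc∈)
  ...   | tri> _ _ j<i = inj₂ (inj₂ ((λ eq → hits-from-nonedge h (subst IsEdge (sym eq) jc∈)) , inj₂ h))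
    where
    h : Hits (pair i j i≢j) (pair j c j≢c)
    h = subst (λ u → Hits u (pair j c j≢c)) (pair-comm j i (i≢j ∘ sym) i≢j)
          (hits (i≢j ∘ sym) j≢c j<i (isEdge⇒adj j≢c jc∈) (isEdge⇒adj i≢c ic∈))

  edges-dominate : DominatingSet G edges
  edges-dominate = record
    { unique    = tabulate⁺ edge-injective
    ; dominates = dominates
    }
    where
    dominates : ∀ w → w ∈ edges ⊎ (∃[ v ] v ∈ edges × Digraph._⟶_ G v w)
    dominates w with isEdge? w
    ... | yes (e , refl) = inj₁ (∈-tabulate⁺ e)
    ... | no  w∉         =
      -- A single edge points to every non-edge; `e₀` witnesses that there is one.
      inj₂ (edge e₀ , ∈-tabulate⁺ e₀ , (λ { refl → w∉ (e₀ , refl) }) , inj₁ w∉)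

  edge-dominator : ∀ {D} → DominatingSet G D → ∀ e →
                   ∃[ v ] v ∈ D × (edge e ≡ v ⊎ Hits v (edge e))
  edge-dominator dom e with DominatingSet.dominates dom (edge e)
  ... | inj₁ e∈D                       = edge e , e∈D , inj₁ refl
  ... | inj₂ (v , v∈D , _ , inj₁ e∉)   = contradiction (e , refl) e∉
  ... | inj₂ (v , v∈D , _ , inj₂ h)    = v , v∈D , inj₂ h

  -- A vertex that is an edge dominates itself and hits nothing, as hits start at non-edges; any
  -- other vertex hits at most one edge. Hence no vertex dominates two edges.
  dominator-injective : ∀ {u v w w′} → u ≡ v → IsEdge w → IsEdge w′ →
                        w ≡ u ⊎ Hits u w → w′ ≡ v ⊎ Hits v w′ → w ≡ w′
  dominator-injective u≡v w∈ w′∈ (inj₁ refl) (inj₁ refl) = u≡v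
  dominator-injective refl w∈ w′∈ (inj₁ refl) (inj₂ h)   = contradiction w∈ (hits-from-nonedge h)
  dominator-injective refl w∈ w′∈ (inj₂ h) (inj₁ refl)   = contradiction w′∈ (hits-from-nonedge h)
  dominator-injective u≡v w∈ w′∈ (inj₂ h) (inj₂ h′)      = hits-unique u≡v h h′

  dominationNumber : DominationNumber G N
  dominationNumber = record
    { attained = edges , edges-dominate , length-tabulate edge
    ; minimal  = λ D dom →
        -- Sending each edge to the position in `D` of a chosen dominator is an injection from
        -- `Fin N` into the positions of `D`.
        let position e = index (proj₁ (proj₂ (edge-dominator dom e))) in
        Fin.injective⇒≤ {f = position} λ {e} {f} eq →
          let v , v∈ , v→e = edge-dominator dom e
              u , u∈ , u→f = edge-dominator dom f
          in edge-injective (dominator-injective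
               (trans (lookup-index v∈) (trans (cong (lookup D) eq) (sym (lookup-index u∈))))
               (e , refl) (f , refl) v→e u→f)
    }


-- Point-line incidences of the affine plane over a prime field.

∣%-difference : ∀ {p} .{{_ : NonZero p}} a b → a % p ≡ b % p → + p ℤ.∣ + a ℤ.- + b
∣%-difference {p} a b eq = ℤ.divides (+ (a / p) ℤ.- + (b / p)) (begin
  + a ℤ.- + b
    ≡⟨ cong₂ ℤ._-_ (division a) (division b) ⟩
  (+ (a % p) ℤ.+ + (a / p) ℤ.* + p) ℤ.- (+ (b % p) ℤ.+ + (b / p) ℤ.* + p)
    ≡⟨ cong (λ r → (+ r ℤ.+ + (a / p) ℤ.* + p) ℤ.- (+ (b % p) ℤ.+ + (b / p) ℤ.* + p)) eq ⟩
  (+ (b % p) ℤ.+ + (a / p) ℤ.* + p) ℤ.- (+ (b % p) ℤ.+ + (b / p) ℤ.* + p)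
    ≡⟨ cancel (+ (b % p)) (+ (a / p)) (+ (b / p)) (+ p) ⟩
  (+ (a / p) ℤ.- + (b / p)) ℤ.* + p ∎)
  where
  open ≡-Reasoning
  division : ∀ n → + n ≡ + (n % p) ℤ.+ + (n / p) ℤ.* + p
  division n = trans (cong +_ (m≡m%n+[m/n]*n n p)) (cong (λ z → + (n % p) ℤ.+ z) (ℤ.pos-* (n / p) p))
  cancel : ∀ r q q′ d → (r ℤ.+ q ℤ.* d) ℤ.- (r ℤ.+ q′ ℤ.* d) ≡ (q ℤ.- q′) ℤ.* d
  cancel = ℤ-solve-∀

-- Two residues differ by less than `p` in absolute value, and 0 is the only multiple of `p` in that
-- range.
∣-difference⇒≡ : ∀ {p} (i j : Fin p) → p ∣ ℤ.∣ + toℕ i ℤ.- + toℕ j ∣ → i ≡ j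
∣-difference⇒≡ {p} i j p∣i-j with ℤ.∣ + toℕ i ℤ.- + toℕ j ∣ in eq | p∣i-j
... | zero    | _     =
  Fin.toℕ-injective (ℤ.+-injective (ℤ.i-j≡0⇒i≡j (+ toℕ i) (+ toℕ j) (ℤ.∣i∣≡0⇒i≡0 eq)))
... | d@(suc _) | p∣d = contradiction (∣⇒≤ p∣d) (<⇒≱ (begin-strict
  d                               ≡⟨ eq ⟨
  ℤ.∣ + toℕ i ℤ.- + toℕ j ∣       ≡⟨ cong ℤ.∣_∣ (ℤ.m-n≡m⊖n (toℕ i) (toℕ j)) ⟩
  ℤ.∣ toℕ i ℤ.⊖ toℕ j ∣           ≤⟨ ℤ.∣m⊝n∣≤m⊔n (toℕ i) (toℕ j) ⟩
  toℕ i ⊔ toℕ j                   <⟨ ⊔-pres-<m (Fin.toℕ<n i) (Fin.toℕ<n j) ⟩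
  p                               ∎))
  where open ≤-Reasoning

-- Edges are indexed by triples (x, m, b) in 𝔽ₚ³, joining the point
-- (x, m x + b) to the line y = m x + b.
module AffinePlane {p} (prime[p] : Prime p) where
  private instance
    p≢0 : NonZero p
    p≢0 = prime⇒nonZero prime[p]

  line : (x m b : Fin p) → Fin p
  line x m b = fromℕ< (m%n<n (toℕ m * toℕ x + toℕ b) p)

  -- The congruence is moved to ℤ, where slopes and intercepts can be subtracted.
  line-difference : ∀ x m b m′ b′ → line x m b ≡ line x m′ b′ →
    + p ℤ.∣ (+ toℕ m ℤ.- + toℕ m′) ℤ.* + toℕ x ℤ.+ (+ toℕ b ℤ.- + toℕ b′)
  line-difference x m b m′ b′ eq = subst (+ p ℤ.∣_)
    (trans (cong₂ ℤ._-_ (cast m b) (cast m′ b′))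
           (regroup (+ toℕ x) (+ toℕ m) (+ toℕ b) (+ toℕ m′) (+ toℕ b′)))
    (∣%-difference (toℕ m * toℕ x + toℕ b) (toℕ m′ * toℕ x + toℕ b′)
      (Fin.fromℕ<-injective _ _ _ _ eq))
    where
    cast : ∀ m b → + (toℕ m * toℕ x + toℕ b) ≡ + toℕ m ℤ.* + toℕ x ℤ.+ + toℕ b
    cast m b = cong (λ z → z ℤ.+ + toℕ b) (ℤ.pos-* (toℕ m) (toℕ x))
    regroup : ∀ x m b m′ b′ → (m ℤ.* x ℤ.+ b) ℤ.- (m′ ℤ.* x ℤ.+ b′)
                            ≡ (m ℤ.- m′) ℤ.* x ℤ.+ (b ℤ.- b′)
    regroup = ℤ-solve-∀

  -- Subtracting the two congruences eliminates the intercepts and leaves `p ∣ Δm * Δx`. Primality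
  -- then forces equal abscissas or equal slopes, and equal slopes force equal intercepts.
  two-points : ∀ {x x′ m b m′ b′} → line x m b ≡ line x m′ b′ → line x′ m b ≡ line x′ m′ b′ →
               x ≡ x′ ⊎ (m ≡ m′ × b ≡ b′)
  two-points {x} {x′} {m} {b} {m′} {b′} eq eq′ = Sum.swap (Sum.map same-line (∣-difference⇒≡ x x′)
    (euclidsLemma ℤ.∣ Δm ∣ ℤ.∣ Δx ∣ prime[p] (subst (p ∣_) (ℤ.abs-* Δm Δx) (ℤ.∣⇒∣ᵤ p∣Δm*Δx))))
    where
    Δm = + toℕ m ℤ.- + toℕ m′
    Δx = + toℕ x ℤ.- + toℕ x′
    Δb = + toℕ b ℤ.- + toℕ b′
    p∣Δm*Δx : + p ℤ.∣ Δm ℤ.* Δx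
    p∣Δm*Δx = subst (+ p ℤ.∣_) (cancel Δm Δb (+ toℕ x) (+ toℕ x′))
      (ℤ.∣m∣n⇒∣m-n {m = Δm ℤ.* + toℕ x ℤ.+ Δb} {Δm ℤ.* + toℕ x′ ℤ.+ Δb}
        (line-difference x m b m′ b′ eq) (line-difference x′ m b m′ b′ eq′))
      where
      cancel : ∀ m b x x′ → (m ℤ.* x ℤ.+ b) ℤ.- (m ℤ.* x′ ℤ.+ b) ≡ m ℤ.* (x ℤ.- x′)
      cancel = ℤ-solve-∀
    same-line : p ∣ ℤ.∣ Δm ∣ → m ≡ m′ × b ≡ b′
    same-line p∣Δm = ∣-difference⇒≡ m m′ p∣Δm , ∣-difference⇒≡ b b′
      (ℤ.∣⇒∣ᵤ (ℤ.∣m+n∣m⇒∣n {m = Δm ℤ.* + toℕ x} (line-difference x m b m′ b′ eq)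
        (ℤ.∣m⇒∣m*n {m = Δm} (+ toℕ x) (ℤ.∣ᵤ⇒∣ p∣Δm))))

  incidences : ∀ {k} → p * p + p * p ≤ k → C₄-free-bipartite k (p * (p * p))
  incidences {k} 2p²≤k = record
    -- The points occupy the first p² vertices and the lines the next p². An edge is recovered from
    -- the abscissa of its point together with its line.
    { src     = λ e → embed (point e ↑ˡ p * p)
    ; tgt     = λ e → embed (p * p ↑ʳ mb e)
    ; src≢tgt = λ e f eq → inl≢inr (trans (sym (Fin.splitAt-↑ˡ (p * p) (point e) (p * p)))
        (trans (cong (Fin.splitAt (p * p)) (embed-injective eq)) (Fin.splitAt-↑ʳ (p * p) (p * p) (mb f))))
    ; simple  = λ {e} {f} s≡ t≡ → trans (sym (Fin.combine-remQuot {p} (p * p) e))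
        (trans (cong₂ combine (proj₁ (point≡ s≡)) (mb≡ t≡)) (Fin.combine-remQuot {p} (p * p) f))
    ; C₄-free = λ {e₁} {e₂} {e₃} {e₄} s₁₂ s₃₄ t₁₃ t₂₄ →
        c₄-free e₁ e₂ e₃ e₄ (point≡ s₁₂) (point≡ s₃₄) (mb≡ t₁₃) (mb≡ t₂₄)
    }
    where
    embed : Fin (p * p + p * p) → Fin k
    embed i = inject≤ i 2p²≤k
    embed-injective : ∀ {i j} → embed i ≡ embed j → i ≡ j
    embed-injective = Fin.inject≤-injective 2p²≤k 2p²≤k _ _
    inl≢inr : ∀ {A B : Set} {a : A} {b : B} → inj₁ a ≢ inj₂ b
    inl≢inr ()
    X : Fin (p * (p * p)) → Fin p
    X e = proj₁ (remQuot {p} (p * p) e)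
    mb : Fin (p * (p * p)) → Fin (p * p)
    mb e = proj₂ (remQuot {p} (p * p) e)
    Y : Fin p → Fin (p * p) → Fin p
    Y x l = line x (proj₁ (remQuot {p} p l)) (proj₂ (remQuot {p} p l))
    point : Fin (p * (p * p)) → Fin (p * p)
    point e = combine (X e) (Y (X e) (mb e))
    point≡ : ∀ {e f} → embed (point e ↑ˡ p * p) ≡ embed (point f ↑ˡ p * p) →
             X e ≡ X f × Y (X e) (mb e) ≡ Y (X f) (mb f)
    point≡ {e} {f} eq = Fin.combine-injective (X e) _ (X f) _
      (Fin.↑ˡ-injective (p * p) _ _ (embed-injective eq))
    mb≡ : ∀ {e f} → embed (p * p ↑ʳ mb e) ≡ embed (p * p ↑ʳ mb f) → mb e ≡ mb f
    mb≡ eq = Fin.↑ʳ-injective (p * p) _ _ (embed-injective eq)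
    c₄-free : ∀ e₁ e₂ e₃ e₄ →
              X e₁ ≡ X e₂ × Y (X e₁) (mb e₁) ≡ Y (X e₂) (mb e₂) →
              X e₃ ≡ X e₄ × Y (X e₃) (mb e₃) ≡ Y (X e₄) (mb e₄) →
              mb e₁ ≡ mb e₃ → mb e₂ ≡ mb e₄ →
              embed (point e₁ ↑ˡ p * p) ≡ embed (point e₃ ↑ˡ p * p)
              ⊎ embed (p * p ↑ʳ mb e₁) ≡ embed (p * p ↑ʳ mb e₂)
    c₄-free e₁ e₂ e₃ e₄ (x₁₂ , y₁₂) (x₃₄ , y₃₄) l₁₃ l₂₄ =
      Sum.map
        (λ x₁₃ → cong (λ i → embed (i ↑ˡ p * p)) (cong₂ (λ x l → combine x (Y x l)) x₁₃ l₁₃))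
        (λ (m₁₂ , b₁₂) → cong (λ l → embed (p * p ↑ʳ l))
          (trans (sym (Fin.combine-remQuot {p} p (mb e₁)))
            (trans (cong₂ combine m₁₂ b₁₂) (Fin.combine-remQuot {p} p (mb e₂)))))
        -- The lines of `e₁` and `e₂` agree at the abscissa of `e₁` and at that of `e₃`.
        (two-points
          (trans y₁₂ (cong (λ x → Y x (mb e₂)) (sym x₁₂)))
          (trans (cong (Y (X e₃)) l₁₃) (trans y₃₄ (cong₂ Y (sym x₃₄) (sym l₂₄)))))

-- Fitting the prime to k, and the final bounds.

locate : (f : ℕ → ℕ) → (∀ u → f u < f (suc u)) → ∀ k → f 0 ≤ k → ∃[ u ] f u ≤ k × k < f (suc u)
locate f f-mono zero    f0≤0 = 0 , f0≤0 , ≤-<-trans z≤n (f-mono 0)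
locate f f-mono (suc k) f0≤1+k with m≤n⇒m<n∨m≡n f0≤1+k
... | inj₂ f0≡1+k     = 0 , f0≤1+k , subst (_< f 1) f0≡1+k (f-mono 0)
... | inj₁ (s≤s f0≤k) with locate f f-mono k f0≤k
...   | u , lo , hi with m≤n⇒m<n∨m≡n hi
...     | inj₁ 1+k< = u , m≤n⇒m≤1+n lo , 1+k<
...     | inj₂ 1+k≡ = suc u , ≤-reflexive (sym 1+k≡) , subst (_< f (suc (suc u))) (sym 1+k≡) (f-mono (suc u))

-- This is 2p² at the largest admissible p = 16x²: the number of vertices that suffices for any
-- prime found from x.
scale : ℕ → ℕ
scale x = 2 * (16 * (x * x) * (16 * (x * x)))

scale-2* : ∀ x → scale (2 * x) ≡ 2 * (64 * 64) * (x * x * (x * x))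
scale-2* x = trans (cong (2 *_) (cong₂ _*_ (quadruple 16 x) (quadruple 16 x))) (regroup 64 (x * x))
  where
  quadruple : ∀ c x → c * (2 * x * (2 * x)) ≡ c * 4 * (x * x)
  quadruple = solve-∀
  regroup : ∀ a y → 2 * (a * y * (a * y)) ≡ 2 * (a * a) * (y * y)
  regroup = solve-∀

scale-mono-< : ∀ {x y} → x < y → scale x < scale y
scale-mono-< x<y = *-monoʳ-< 2 (*-mono-< 16x²< 16x²<)
  where 16x²< = *-monoʳ-< 16 (*-mono-< x<y x<y)

-- The upper bound on p makes the plane fit into k vertices; the lower bound x² < p turns k <
-- 2·(64x²)² into a bound by a multiple of p². The 64 is 16·2², from doubling x.
scale-sandwich : ∀ {k p} x → scale x ≤ k → k < scale (2 * x) → x * x < p → p ≤ 16 * (x * x) →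
                 p * p + p * p ≤ k × k ≤ 2 * (64 * 64) * (p * p)
scale-sandwich {k} {p} x lo hi x²<p p≤16x² =
  (begin
    p * p + p * p      ≡⟨ cong (λ y → p * p + y) (+-identityʳ (p * p)) ⟨
    2 * (p * p)        ≤⟨ *-monoʳ-≤ 2 (*-mono-≤ p≤16x² p≤16x²) ⟩
    scale x            ≤⟨ lo ⟩
    k                  ∎) ,
  (begin
    k                                   ≤⟨ <⇒≤ hi ⟩
    scale (2 * x)                       ≡⟨ scale-2* x ⟩
    2 * (64 * 64) * (x * x * (x * x))   ≤⟨ *-monoʳ-≤ (2 * (64 * 64)) (*-mono-≤ (<⇒≤ x²<p) (<⇒≤ x²<p)) ⟩
    2 * (64 * 64) * (p * p)             ∎)
  where open ≤-Reasoning

prime-near-√k : ∀ k → scale (2 ^ 4) ≤ k →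
                ∃[ p ] Prime p × p * p + p * p ≤ k × k ≤ 2 * (64 * 64) * (p * p)
prime-near-√k k lo₀
  with u , lo , hi ← locate (λ u → scale (2 ^ (4 + u)))
                            (λ u → scale-mono-< (^-monoʳ-< 2 ≤-refl (n<1+n (4 + u)))) k lo₀
  with p , P , x²<p , p≤16x² ← prime-in-[x²,16x²] u =
  p , P , scale-sandwich (2 ^ (4 + u)) lo hi x²<p p≤16x²

k³≤c³d² : ∀ {c k p} → k ≤ c * (p * p) → k ^ 3 ≤ c ^ 3 * (p * (p * p)) ^ 2
k³≤c³d² {c} {k} {p} k≤ = ≤-trans (^-monoˡ-≤ 3 k≤) (≤-reflexive (regroup c p))
  where
  regroup : ∀ c p → let a = c * (p * p) ; d = p * (p * p) in
            a * (a * (a * 1)) ≡ c * (c * (c * 1)) * (d * (d * 1))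
  regroup = solve-∀

-- Since log k ≥ E, the factor 64 log k absorbs the constant `c ^ 3`.
√log-bound-intro : ∀ {c E k d} → k ^ 3 ≤ c ^ 3 * d ^ 2 → c ^ 3 ≤ 64 * E → 2 ^ E ≤ k →
                  d ≥k^3/2÷8√log k
√log-bound-intro {c} {E} {k} {d} k³≤ c³≤64E 2^E≤k = begin
  2 ^ (k ^ 3)               ≤⟨ ^-monoʳ-≤ 2 k³≤ ⟩
  2 ^ (c ^ 3 * d ^ 2)       ≤⟨ ^-monoʳ-≤ 2 (*-monoˡ-≤ (d ^ 2) c³≤64E) ⟩
  2 ^ (64 * E * d ^ 2)      ≡⟨ cong (2 ^_) (trans (cong (_* d ^ 2) (*-comm 64 E)) (*-assoc E 64 (d ^ 2))) ⟩
  2 ^ (E * (64 * d ^ 2))    ≡⟨ ^-*-assoc 2 E (64 * d ^ 2) ⟨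
  (2 ^ E) ^ (64 * d ^ 2)    ≤⟨ ^-monoˡ-≤ (64 * d ^ 2) 2^E≤k ⟩
  k ^ (64 * d ^ 2)          ∎
  where open ≤-Reasoning

-- No logarithm is lost, hence exponent 0. Raising `c ^ 3` to `c ^ 4` makes the constant a perfect
-- square.
Ω̃-bound-intro : ∀ {c k d} .{{_ : NonZero c}} → k ^ 3 ≤ c ^ 3 * d ^ 2 → Ω̃-bound (c ^ 2) 0 k d
Ω̃-bound-intro {c} {k} {d} k³≤ = begin
  k ^ 3                     ≤⟨ k³≤ ⟩
  c ^ 3 * d ^ 2             ≤⟨ *-monoˡ-≤ (d ^ 2) (^-monoʳ-≤ c (n≤1+n 3)) ⟩
  c ^ 4 * d ^ 2             ≡⟨ regroup c d ⟩
  (c ^ 2 * d * 1) ^ 2       ∎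
  where
  open ≤-Reasoning
  regroup : ∀ c d → let a = c * (c * 1) * d * 1 in
            c * (c * (c * (c * 1))) * (d * (d * 1)) ≡ a * (a * 1)
  regroup = solve-∀

domination-lower-bound : ∀ {K₀ C} .{{_ : NonZero C}} →
  (∀ k → K₀ ≤ k → ∃[ p ] Prime p × p * p + p * p ≤ k × k ≤ C * (p * p)) →
  ∃[ K ] ∃[ c ] ∃[ e ] ∀ k → K ≤ k →
    ∃[ G ] TriangularSubstructure {k} G ×
    (∃[ d ] DominationNumber G d × (d ≥k^3/2÷8√log k) × Ω̃-bound c e k d)
-- The threshold exceeds both `K₀`, for the prime to exist, and `2 ^ E`, for the logarithm to absorb
-- the constant.
domination-lower-bound {K₀} {C} near = K₀ + 2 ^ E , C ^ 2 , 0 , bound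
  where
  E = C ^ 3
  bound : ∀ k → K₀ + 2 ^ E ≤ k →
    ∃[ G ] TriangularSubstructure {k} G ×
    (∃[ d ] DominationNumber G d × (d ≥k^3/2÷8√log k) × Ω̃-bound (C ^ 2) 0 k d)
  bound k K≤k with p , P , 2p²≤k , k≤Cp² ← near k (m+n≤o⇒m≤o K₀ K≤k) =
    G , triangular , d , dominationNumber ,
    √log-bound-intro {C} {E} {k} {d} k³≤C³d² (m≤n*m E 64) (m+n≤o⇒n≤o K₀ K≤k) ,
    Ω̃-bound-intro {C} {k} {d} k³≤C³d²
    where
    d = p * (p * p)
    instance
      p≢0 : NonZero p
      p≢0 = prime⇒nonZero P
      p²≢0 : NonZero (p * p)
      p²≢0 = m*n≢0 p p
      p³≢0 : NonZero d
      p³≢0 = m*n≢0 p (p * p)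
    open Construction (AffinePlane.incidences P 2p²≤k) (fromℕ< (>-nonZero⁻¹ d))
    k³≤C³d² : k ^ 3 ≤ C ^ 3 * d ^ 2
    k³≤C³d² = k³≤c³d² {C} {k} {p} k≤Cp²

theorem18 : ∃[ K ] ∃[ c ] ∃[ e ] ∀ (k : ℕ) → K ≤ k →
    ∃[ G ] TriangularSubstructure {k} G ×
    (∃[ d ] DominationNumber G d × (d ≥k^3/2÷8√log k) × Ω̃-bound c e k d)
theorem18 = domination-lower-bound {scale (2 ^ 4)} {2 * (64 * 64)} prime-near-√k
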